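{- For all integers $n,k\geqslant 1$, $$(-1)^{k-1}\sum_{j=0}^{k-1} (-1)^{j}\Big(\mathrm{pod}\big(n-j(2j+1)\big)-\mathrm{pod}\big(n-(j+1)(2j+1)\big)\Big)\geqslant 0,$$ with strict inequality if $n\geqslant (2k+1)k$. For example, for all $n\geqslant 1$, $$\mathrm{pod}(n)-\mathrm{pod}(n-1)-\mathrm{pod}(n-3)+\mathrm{pod}(n-6)\leqslant 0,$$ $$\mathrm{pod}(n)-\mathrm{pod}(n-1)-\mathrm{pod}(n-3)+\mathrm{pod}(n-6)+\mathrm{pod}(n-10)-\mathrm{pod}(n-15)\geqslant 0.$$
   Context: $\mathrm{pod}(n)$ denotes the number of partitions of $n$ wherein odd parts are distinct (even parts may repeat), with $\mathrm{pod}(0)=1$ and $\mathrm{pod}(m)=0$ for all negative integers $m$. Equivalently, $\sum_{n=0}^{\infty}\mathrm{pod}(n) q^n=\prod_{n=1}^\infty \frac{1+q^{2n-1}}{1-q^{2n}}=1+q+q^2+2q^3+3q^4+4q^5+5q^6+7q^7+\cdots$. -}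

module Defs where

open import Data.Empty using (⊥-elim)
open import Data.Integer.Base using (ℤ; +_; -[1+_]; 0ℤ)
open import Data.List.Base using (List; []; _∷_; [_]; _++_; map; filter; length)
open import Data.List.Membership.Propositional using (_∈_)
open import Data.List.Membership.Propositional.Properties
  using (∈-++⁺ˡ; ∈-++⁺ʳ; ∈-++⁻; ∈-map⁺; ∈-map⁻; ∈-filter⁺; ∈-filter⁻)
open import Data.List.Properties using (∷-injectiveʳ)
open import Data.List.Relation.Unary.All using (All; []; _∷_; all?)
open import Data.List.Relation.Unary.AllPairs using ([]; _∷_)
open import Data.List.Relation.Unary.Any using (here)
open import Data.List.Relation.Unary.Linked using (Linked; []; [-]; _∷_; linked?)
open import Data.List.Relation.Unary.Unique.Propositional using (Unique)
import Data.List.Relation.Unary.Unique.Propositional.Properties as Unique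
open import Data.Nat.Base
  using (ℕ; zero; suc; _≤_; _≥_; z≤n; s≤s; s≤s⁻¹)
open import Data.Nat.ListAction using (sum)
open import Data.Nat.Divisibility using (_∣_; _∣?_)
open import Data.Nat.Properties
  using (_≟_; _≤?_; _≥?_; ≤-refl; ≤-reflexive; ≤-trans; n≤1+n; 1+n≰n; m≤m+n; +-mono-≤; ≤∧≢⇒<)
open import Data.List.Relation.Unary.Unique.DecPropositional _≟_ using (unique?)
open import Data.Product.Base using (_×_; _,_; proj₂)
open import Data.Sum.Base using (inj₁; inj₂)
open import Relation.Binary.PropositionalEquality.Core using (_≡_; refl)
open import Relation.Nullary.Decidable using (yes; no; map′; _×-dec_; ¬?)
open import Relation.Nullary.Negation using (¬_)
open import Relation.Unary using (Decidable)

Odd : ℕ → Set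
Odd m = ¬ (2 ∣ m)

odd? : Decidable Odd
odd? m = ¬? (2 ∣? m)

-- A partition is the list of its parts in weakly decreasing order, so that
-- each partition is represented by exactly one list.
record IsPartition (n : ℕ) (p : List ℕ) : Set where
  constructor mkIsPartition
  field
    positive   : All (1 ≤_) p
    decreasing : Linked _≥_ p
    total      : sum p ≡ n

record IsPodPartition (n : ℕ) (p : List ℕ) : Set where
  constructor mkIsPodPartition
  field
    isPartition : IsPartition n p
    oddDistinct : Unique (filter odd? p)

  open IsPartition isPartition public

isPartition? : ∀ n → Decidable (IsPartition n)
isPartition? n p =
  map′ (λ (a , b , c) → mkIsPartition a b c)
       (λ (mkIsPartition a b c) → a , b , c)
       (all? (1 ≤?_) p ×-dec linked? _≥?_ p ×-dec sum p ≟ n)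

isPodPartition? : ∀ n → Decidable (IsPodPartition n)
isPodPartition? n p =
  map′ (λ (a , b) → mkIsPodPartition a b)
       (λ (mkIsPodPartition a b) → a , b)
       (isPartition? n p ×-dec unique? (filter odd? p))

-- All weakly decreasing lists of at most l numbers taken from {1, …, m}.
-- Every partition of n occurs among them for l = m = n.
descending : ℕ → ℕ → List (List ℕ)
descending zero    _       = [ [] ]
descending (suc l) zero    = [ [] ]
descending (suc l) (suc m) =
  descending (suc l) m ++ map (suc m ∷_) (descending l (suc m))

podPartitions : ℕ → List (List ℕ)
podPartitions n = filter (isPodPartition? n) (descending n n)

countPod : ℕ → ℕ
countPod n = length (podPartitions n)

pod : ℤ → ℤ
pod (+ n)    = + countPod n
pod -[1+ _ ] = 0ℤ

-- The enumeration is exact: podPartitions n lists every partition of n with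
-- distinct odd parts, nothing else, and none of them twice.

private
  widen : ∀ {m m′ p} → m ≤ m′ → Linked _≥_ (m ∷ p) → Linked _≥_ (m′ ∷ p)
  widen m≤m′ [-]       = [-]
  widen m≤m′ (x≤m ∷ d) = ≤-trans x≤m m≤m′ ∷ d

  []∈descending : ∀ l m → [] ∈ descending l m
  []∈descending zero    m       = here refl
  []∈descending (suc l) zero    = here refl
  []∈descending (suc l) (suc m) = ∈-++⁺ˡ ([]∈descending (suc l) m)

∈-descending⁻ : ∀ l m {p} → p ∈ descending l m → Linked _≥_ (m ∷ p)
∈-descending⁻ zero    m       (here refl) = [-]
∈-descending⁻ (suc l) zero    (here refl) = [-]
∈-descending⁻ (suc l) (suc m) p∈ with ∈-++⁻ (descending (suc l) m) p∈
... | inj₁ p∈ˡ = widen (n≤1+n m) (∈-descending⁻ (suc l) m p∈ˡ)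
... | inj₂ p∈ʳ with ∈-map⁻ (suc m ∷_) p∈ʳ
...   | _ , q∈ , refl = ≤-refl ∷ ∈-descending⁻ l (suc m) q∈

∈-descending⁺ : ∀ l m {p} → All (1 ≤_) p → Linked _≥_ (m ∷ p) → length p ≤ l →
                p ∈ descending l m
∈-descending⁺ l       m    {[]}     _          _          _         = []∈descending l m
∈-descending⁺ (suc l) zero {x ∷ xs} (1≤x ∷ _)  (x≤0 ∷ _)  _         = ⊥-elim (1+n≰n (≤-trans 1≤x x≤0))
∈-descending⁺ (suc l) (suc m) {x ∷ xs} (1≤x ∷ ps) (x≤m ∷ d) (s≤s len) with x ≟ suc m
... | yes refl = ∈-++⁺ʳ (descending (suc l) m)
                   (∈-map⁺ (suc m ∷_) (∈-descending⁺ l (suc m) ps d len))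
... | no  x≢m  = ∈-++⁺ˡ (∈-descending⁺ (suc l) m (1≤x ∷ ps)
                   (s≤s⁻¹ (≤∧≢⇒< x≤m x≢m) ∷ d) (s≤s len))

descending-unique : ∀ l m → Unique (descending l m)
descending-unique zero    m       = [] ∷ []
descending-unique (suc l) zero    = [] ∷ []
descending-unique (suc l) (suc m) =
  Unique.++⁺ (descending-unique (suc l) m)
             (Unique.map⁺ ∷-injectiveʳ (descending-unique l (suc m)))
             disjoint
  where
  disjoint : ∀ {p} → ¬ (p ∈ descending (suc l) m × p ∈ map (suc m ∷_) (descending l (suc m)))
  disjoint (p∈ˡ , p∈ʳ) with ∈-map⁻ (suc m ∷_) p∈ʳ
  ... | _ , _ , refl with ∈-descending⁻ (suc l) m p∈ˡ
  ...   | 1+m≤m ∷ _ = 1+n≰n 1+m≤m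

private
  length≤sum : ∀ {p} → All (1 ≤_) p → length p ≤ sum p
  length≤sum []         = z≤n
  length≤sum (1≤x ∷ ps) = +-mono-≤ 1≤x (length≤sum ps)

  bounded : ∀ {n p} → Linked _≥_ p → sum p ≤ n → Linked _≥_ (n ∷ p)
  bounded {p = []}     _ _   = [-]
  bounded {p = x ∷ xs} d s≤n = ≤-trans (m≤m+n x (sum xs)) s≤n ∷ d

∈-podPartitions⁺ : ∀ {n p} → IsPodPartition n p → p ∈ podPartitions n
∈-podPartitions⁺ {n} pod-p =
  ∈-filter⁺ (isPodPartition? n)
    (∈-descending⁺ n n positive (bounded decreasing (≤-reflexive total))
      (≤-trans (length≤sum positive) (≤-reflexive total)))
    pod-p
  where open IsPodPartition pod-p

∈-podPartitions⁻ : ∀ {n p} → p ∈ podPartitions n → IsPodPartition n p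
∈-podPartitions⁻ {n} p∈ = proj₂ (∈-filter⁻ (isPodPartition? n) {xs = descending n n} p∈)

podPartitions-unique : ∀ n → Unique (podPartitions n)
podPartitions-unique n = Unique.filter⁺ (isPodPartition? n) (descending-unique n n)

_ : map countPod (0 ∷ 1 ∷ 2 ∷ 3 ∷ 4 ∷ 5 ∷ 6 ∷ 7 ∷ []) ≡
    1 ∷ 1 ∷ 1 ∷ 2 ∷ 3 ∷ 4 ∷ 5 ∷ 7 ∷ []
_ = refl

{-# OPTIONS --safe #-}

-- Let A_i count the pod partitions with parts at most 2i and let P be the
-- generating function of pod. Put
--   T_k = A_k (1 - q^(2k)) q^(k(2k+1)) ∑_i A_i q^(2(k+1)i) / (1 - q^(2(k+i))).
-- Adding the terms of T_k and T_{k+1} with the same k + i cancels that last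
-- denominator, and the q-binomial theorem then gives
--   T_k + T_{k+1} = q^(k(2k+1)) (1 - q^(2k+1)) P,    T_1 = (1 - q) P - 1.
-- So T_k is the signed truncated sum, up to its constant term. With the
-- subtracted terms moved to the other side everything happens in ℕ[[q]], where
-- nonnegativity is automatic; the coefficients of T_k from q^(k(2k+1)) on are
-- positive because T_k dominates q^(k(2k+1)) A_k coefficientwise.
module Submission where

open import Algebra.Bundles using (CommutativeMonoid; CommutativeSemiring)
import Algebra.Construct.Pointwise as Pointwise
open import Algebra.Definitions using (LeftCancellative)
import Algebra.Solver.Ring.NaturalCoefficients.Default as SemiringSolver
open import Algebra.Structures.Biased using (isCommutativeSemiringˡ; isCommutativeMonoidˡ)
open import Data.Bool using (true; false)
open import Data.Fin using (toℕ)
open import Data.Fin.Properties using (toℕ-inject₁; toℕ-fromℕ)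
open import Data.Integer as ℤ using (ℤ; +_; _⊖_; 0ℤ; 1ℤ; -1ℤ)
import Data.Integer.Properties as ℤ
open import Data.Integer.Properties using (+-0-commutativeMonoid)
open import Algebra.Properties.CommutativeMonoid.Sum +-0-commutativeMonoid using (sum-syntax; sum-init-last; sum-cong-≗)
import Data.Integer.Solver as ℤSolver
open import Data.List.Base using (List; []; _∷_; _++_; map; filter; length)
open import Data.List.Properties using (filter-++; filter-none; filter-accept; filter-reject; length-++)
open import Data.List.Relation.Unary.All as All using (All; []; _∷_)
import Data.List.Relation.Unary.All.Properties as All
open import Data.List.Relation.Unary.AllPairs using ([]; _∷_)
open import Data.List.Relation.Unary.Linked as Linked using (Linked; [-]; _∷_)
open import Data.List.Relation.Unary.Linked.Properties using (Linked⇒All)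
open import Data.List.Relation.Unary.Unique.Propositional using (Unique)
open import Data.Nat as ℕ using (ℕ; zero; suc; s≤s; z≤n)
open import Data.Nat.Divisibility using (_∣_; n∣m*n; ∣m+n∣m⇒∣n; ∣1⇒≡1)
import Data.Nat.Properties as ℕ
import Data.Nat.Solver as ℕSolver
open import Data.Product using (_×_; _,_; proj₁)
open import Function.Base using (_∘_)
open import Function.Bundles using (_⇔_; mk⇔; Equivalence)
open import Level using (Level; 0ℓ)
open import Relation.Binary.PropositionalEquality as ≡ using (_≡_)
open import Relation.Nullary using (¬_; does; yes; no; contradiction)
open import Relation.Unary using (Decidable)
open import Defs

-- Series identities over an abstract commutative semiring

module Truncation {r₁ r₂ : Level} (R : CommutativeSemiring r₁ r₂) where

  open CommutativeSemiring R

  -- `Σ f` stands for ∑ᵢ qⁱ f i: the built-in weight qⁱ makes the sum converge coefficientwise for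
  -- any `f`. Additive cancellation takes the place of subtraction.
  module WithSum
    (+-cancelˡ : LeftCancellative _≈_ _+_)
    (q : Carrier)
    (Σ : (ℕ → Carrier) → Carrier)
    (Σ-cong : ∀ {f g} → (∀ i → f i ≈ g i) → Σ f ≈ Σ g)
    (Σ-unfold : ∀ f → Σ f ≈ f 0 + q * Σ (λ i → f (suc i)))
    (Σ-+ : ∀ f g → Σ (λ i → f i + g i) ≈ Σ f + Σ g)
    (Σ-* : ∀ c f → Σ (λ i → c * f i) ≈ c * Σ f)
    where

    open import Algebra.Properties.Semiring.Exp semiring
      using (_^_; ^-homo-*)
    open SemiringSolver R
      using (solve; _:+_; _:*_; _:=_; con)
    open import Relation.Binary.Reasoning.Setoid setoid

    -- 1 / (1 - q h)
    geom : Carrier → Carrier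
    geom h = Σ (λ i → h ^ i)

    -- This replaces (1 - q h) · `geom h` = 1, which cannot be written without subtraction.
    geom-unfold : ∀ h → geom h ≈ 1# + q * h * geom h
    geom-unfold h = begin
      geom h                             ≈⟨ Σ-unfold _ ⟩
      1# + q * Σ (λ i → h * h ^ i)       ≈⟨ +-congˡ (*-congˡ (Σ-* h _)) ⟩
      1# + q * (h * geom h)              ≈⟨ +-congˡ (*-assoc q h _) ⟨
      1# + q * h * geom h                ∎

    -- q^(2k+1)
    o : ℕ → Carrier
    o zero    = q
    o (suc k) = q * q * o k

    -- 1 / (1 - q^(2i+2))
    D : ℕ → Carrier
    D i = geom (o i)

    -- ∏_{j<i} (1 + q^(2j+1)) / (1 - q^(2j+2)), which counts the pod partitions
    -- with parts at most 2i.
    A : ℕ → Carrier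
    A zero    = 1#
    A (suc i) = A i * (1# + o i) * D i

    o-+ : ∀ i k → o (suc (i ℕ.+ k)) ≈ q * o k * o i
    o-+ zero    k = solve 2 (λ q o → q :* q :* o := q :* o :* q) refl q (o k)
    o-+ (suc i) k = begin
      q * q * o (suc (i ℕ.+ k))  ≈⟨ *-congˡ (o-+ i k) ⟩
      q * q * (q * o k * o i)    ≈⟨ solve 3 (λ q x y → q :* q :* (q :* x :* y) := q :* x :* (q :* q :* y)) refl q (o k) (o i) ⟩
      q * o k * (q * q * o i)    ∎

    -- A factor `o i` inside a series in powers of `c` turns `c` into `q * q * c`; the q-shifts of
    -- `F`, `H` and `V` come from here.
    ^-o : ∀ c i → c ^ i * o i ≈ q * (q * q * c) ^ i
    ^-o c zero    = *-comm 1# q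
    ^-o c (suc i) = begin
      c * c ^ i * (q * q * o i)                ≈⟨ solve 4 (λ c p q o → c :* p :* (q :* q :* o) := q :* q :* c :* (p :* o)) refl c (c ^ i) q (o i) ⟩
      q * q * c * (c ^ i * o i)                ≈⟨ *-congˡ (^-o c i) ⟩
      q * q * c * (q * (q * q * c) ^ i)        ≈⟨ solve 3 (λ d q p → d :* (q :* p) := q :* (d :* p)) refl (q * q * c) q ((q * q * c) ^ i) ⟩
      q * (q * q * c * (q * q * c) ^ i)        ∎

    o-^ : ∀ i → o i ≈ q ^ (2 ℕ.* i ℕ.+ 1)
    o-^ zero    = sym (*-identityʳ q)
    o-^ (suc i) = begin
      q * q * o i                        ≈⟨ *-congˡ (o-^ i) ⟩
      q * q * q ^ (2 ℕ.* i ℕ.+ 1)        ≈⟨ *-assoc q q _ ⟩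
      q ^ (2 ℕ.+ (2 ℕ.* i ℕ.+ 1))        ≡⟨ ≡.cong (λ m → q ^ (m ℕ.+ 1)) (≡.sym (ℕ.*-suc 2 i)) ⟩
      q ^ (2 ℕ.* suc i ℕ.+ 1)            ∎

    -- Clears the denominator 1 - q^(2i+2). Combinatorially, either the part 2i+2 does not occur or
    -- one copy of it can be removed.
    A-suc : ∀ i → A (suc i) ≈ A i * (1# + o i) + q * o i * A (suc i)
    A-suc i = begin
      A i * (1# + o i) * D i                         ≈⟨ *-congˡ (geom-unfold (o i)) ⟩
      A i * (1# + o i) * (1# + q * o i * D i)        ≈⟨ solve 4 (λ a o q d → a :* (con 1 :+ o) :* (con 1 :+ q :* o :* d) := a :* (con 1 :+ o) :+ q :* o :* (a :* (con 1 :+ o) :* d)) refl (A i) (o i) q (D i) ⟩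
      A i * (1# + o i) + q * o i * A (suc i)         ∎

    -- The numerator of the difference is (1 + `o i`) - (1 - q `o i`), which has the factor 1 + q
    -- that `P` also has.
    A-increment : ∀ i → A (suc i) ≈ A i + (1# + q) * (o i * (A i * D i))
    A-increment i = begin
      A i * (1# + o i) * D i                           ≈⟨ solve 3 (λ a o d → a :* (con 1 :+ o) :* d := a :* d :+ a :* o :* d) refl (A i) (o i) (D i) ⟩
      A i * D i + A i * o i * D i                      ≈⟨ +-congʳ (*-congˡ (geom-unfold (o i))) ⟩
      A i * (1# + q * o i * D i) + A i * o i * D i     ≈⟨ solve 4 (λ a o d q → a :* (con 1 :+ q :* o :* d) :+ a :* o :* d := a :+ (con 1 :+ q) :* (o :* (a :* d))) refl (A i) (o i) (D i) q ⟩
      A i + (1# + q) * (o i * (A i * D i))             ∎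

    -- The q-binomial series and the infinite product

    -- ∑ᵢ zⁱ A i at z = q c, the series of the q-binomial theorem.
    F : Carrier → Carrier
    F c = Σ (λ i → c ^ i * A i)

    H : Carrier → Carrier
    H c = Σ (λ i → c ^ i * A (suc i))

    F-unfold : ∀ c → F c ≈ 1# + q * c * H c
    F-unfold c = begin
      F c                                                   ≈⟨ Σ-unfold _ ⟩
      1# * 1# + q * Σ (λ i → c * c ^ i * A (suc i))         ≈⟨ +-cong (*-identityˡ 1#) (*-congˡ (Σ-cong (λ i → *-assoc c _ _))) ⟩
      1# + q * Σ (λ i → c * (c ^ i * A (suc i)))            ≈⟨ +-congˡ (*-congˡ (Σ-* c _)) ⟩
      1# + q * (c * H c)                                    ≈⟨ +-congˡ (*-assoc q c _) ⟨
      1# + q * c * H c                                      ∎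

    -- Multiplying out `A-suc` leaves one term without `o i`, which stays at `c`, and two with it,
    -- which `^-o` moves to `q * q * c`.
    H-step : ∀ c → H c ≈ F c + q * F (q * q * c) + q * q * H (q * q * c)
    H-step c = begin
      H c                                           ≈⟨ Σ-cong term ⟩
      Σ (λ i → f i + q * g i + q * q * h i)         ≈⟨ Σ-+ _ _ ⟩
      Σ (λ i → f i + q * g i) + Σ (λ i → q * q * h i) ≈⟨ +-cong (Σ-+ _ _) (Σ-* _ _) ⟩
      F c + Σ (λ i → q * g i) + q * q * H (q * q * c) ≈⟨ +-congʳ (+-congˡ (Σ-* _ _)) ⟩
      F c + q * F (q * q * c) + q * q * H (q * q * c) ∎
      where
      f g h : ℕ → Carrier
      f i = c ^ i * A i
      g i = (q * q * c) ^ i * A i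
      h i = (q * q * c) ^ i * A (suc i)
      term : ∀ i → c ^ i * A (suc i) ≈ f i + q * g i + q * q * h i
      term i = begin
        c ^ i * A (suc i)
          ≈⟨ *-congˡ (A-suc i) ⟩
        c ^ i * (A i * (1# + o i) + q * o i * A (suc i))
          ≈⟨ solve 5 (λ p a o q b → p :* (a :* (con 1 :+ o) :+ q :* o :* b) := p :* a :+ (p :* o) :* a :+ q :* (p :* o) :* b) refl (c ^ i) (A i) (o i) q (A (suc i)) ⟩
        f i + c ^ i * o i * A i + q * (c ^ i * o i) * A (suc i)
          ≈⟨ +-cong (+-congˡ (*-congʳ (^-o c i))) (*-congʳ (*-congˡ (^-o c i))) ⟩
        f i + q * (q * q * c) ^ i * A i + q * (q * (q * q * c) ^ i) * A (suc i)
          ≈⟨ solve 5 (λ f q p a b → f :+ q :* p :* a :+ q :* (q :* p) :* b := f :+ q :* (p :* a) :+ q :* q :* (p :* b)) refl (f i) q _ (A i) (A (suc i)) ⟩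
        f i + q * g i + q * q * h i ∎

    -- With z = q c this is (1 - z) f(z) = (1 + q z) f(q² z), the functional equation of the
    -- q-binomial theorem in base q².
    F-functional : ∀ c → F c ≈ q * c * F c + (1# + q * q * c) * F (q * q * c)
    F-functional c = begin
      F c                                             ≈⟨ F-unfold c ⟩
      1# + q * c * H c                                ≈⟨ +-congˡ (*-congˡ (H-step c)) ⟩
      1# + q * c * (F c + q * F c′ + q * q * H c′)    ≈⟨ solve 5 (λ q c f g h → con 1 :+ q :* c :* (f :+ q :* g :+ q :* q :* h) := q :* c :* f :+ q :* q :* c :* g :+ (con 1 :+ q :* (q :* q :* c) :* h)) refl q c (F c) (F c′) (H c′) ⟩
      q * c * F c + q * q * c * F c′ + (1# + q * c′ * H c′) ≈⟨ +-congˡ (F-unfold c′) ⟨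
      q * c * F c + q * q * c * F c′ + F c′           ≈⟨ solve 3 (λ x c g → x :+ c :* g :+ g := x :+ (con 1 :+ c) :* g) refl (q * c * F c) c′ (F c′) ⟩
      q * c * F c + (1# + c′) * F c′                  ∎
      where
      c′ : Carrier
      c′ = q * q * c

    -- The infinite product, split by the parity of the largest part.
    P : Carrier
    P = (1# + q) * F q

    -- `F (o k)` is the tail of the product from the factor 1 / (1 - q^(2k+2)) on; each use of
    -- `F-functional` moves its next two factors in front of the series.
    factorisation : ∀ k → A k * (1# + o k) * F (o k) ≈ P
    factorisation zero    = *-congʳ (*-identityˡ _)
    factorisation (suc k) = begin
      A k * (1# + c) * D k * (1# + c′) * F c′     ≈⟨ solve 4 (λ l d s f → l :* d :* s :* f := l :* (d :* (s :* f))) refl (A k * (1# + c)) (D k) (1# + c′) (F c′) ⟩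
      A k * (1# + c) * (D k * ((1# + c′) * F c′)) ≈⟨ *-congˡ (+-cancelˡ (q * c * (D k * F c)) _ _ cancelled) ⟩
      A k * (1# + c) * F c                        ≈⟨ factorisation k ⟩
      P                                           ∎
      where
      c c′ : Carrier
      c  = o k
      c′ = o (suc k)
      -- Instead of dividing by 1 - `q * c`, the same term is added to both sides and cancelled.
      cancelled : q * c * (D k * F c) + D k * ((1# + c′) * F c′) ≈ q * c * (D k * F c) + F c
      cancelled = begin
        q * c * (D k * F c) + D k * ((1# + c′) * F c′)  ≈⟨ solve 4 (λ r d f g → r :* (d :* f) :+ d :* g := d :* (r :* f :+ g)) refl (q * c) (D k) (F c) ((1# + c′) * F c′) ⟩
        D k * (q * c * F c + (1# + c′) * F c′)          ≈⟨ *-congˡ (F-functional c) ⟨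
        D k * F c                                       ≈⟨ *-congʳ (geom-unfold c) ⟩
        (1# + q * c * D k) * F c                        ≈⟨ solve 3 (λ r d f → (con 1 :+ r :* d) :* f := r :* (d :* f) :+ f) refl (q * c) (D k) (F c) ⟩
        q * c * (D k * F c) + F c                       ∎

    -- Convergence of `A` to the product

    -- The sum telescopes; its remainder after m steps keeps a factor q^m and cannot affect
    -- coefficients below degree m.
    partial-sums : ∀ (f h : ℕ → Carrier) → (∀ i → f (suc i) ≈ f i + q ^ i * h i) →
                   ∀ m → f 0 + Σ h ≈ f m + q ^ m * Σ (λ i → h (i ℕ.+ m))
    partial-sums f h step zero    = +-congˡ (begin
      Σ h                               ≈⟨ Σ-cong (λ i → reflexive (≡.cong h (≡.sym (ℕ.+-identityʳ i)))) ⟩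
      Σ (λ i → h (i ℕ.+ 0))             ≈⟨ *-identityˡ _ ⟨
      1# * Σ (λ i → h (i ℕ.+ 0))        ∎)
    partial-sums f h step (suc m) = begin
      f 0 + Σ h                                                     ≈⟨ partial-sums f h step m ⟩
      f m + q ^ m * Σ (λ i → h (i ℕ.+ m))                           ≈⟨ +-congˡ (*-congˡ (Σ-unfold _)) ⟩
      f m + q ^ m * (h m + q * Σ (λ i → h (suc i ℕ.+ m)))           ≈⟨ solve 5 (λ f p h q s → f :+ p :* (h :+ q :* s) := (f :+ p :* h) :+ q :* p :* s) refl (f m) (q ^ m) (h m) q _ ⟩
      f m + q ^ m * h m + q ^ suc m * Σ (λ i → h (suc i ℕ.+ m))     ≈⟨ +-cong (sym (step m)) (*-congˡ (Σ-cong (λ i → reflexive (≡.cong h (≡.sym (ℕ.+-suc i m)))))) ⟩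
      f (suc m) + q ^ suc m * Σ (λ i → h (i ℕ.+ suc m))             ∎

    private
      -- q^(2i+1) `A i` + q^(2i+2) `A (suc i)`, for the pod partitions with largest part 2i+1 or
      -- 2i+2, with one qⁱ removed because `Σ` supplies it.
      largestPart : ℕ → Carrier
      largestPart i = q * (q ^ i * A i) + q * q * (q ^ i * A (suc i))

    o-split : ∀ i → o i ≈ q ^ i * (q * q ^ i)
    o-split zero    = solve 1 (λ q → q := con 1 :* (q :* con 1)) refl q
    o-split (suc i) = begin
      q * q * o i                        ≈⟨ *-congˡ (o-split i) ⟩
      q * q * (q ^ i * (q * q ^ i))      ≈⟨ solve 2 (λ q p → q :* q :* (p :* (q :* p)) := q :* p :* (q :* (q :* p))) refl q (q ^ i) ⟩
      q * q ^ i * (q * (q * q ^ i))      ∎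

    -- Makes the coefficients of `P` accessible: below degree m they are those of `A m`.
    A-tends-to-P : ∀ m → P ≈ A m + q ^ m * Σ (λ i → largestPart (i ℕ.+ m))
    A-tends-to-P m = begin
      (1# + q) * F q                            ≈⟨ solve 2 (λ q f → (con 1 :+ q) :* f := f :+ q :* f) refl q (F q) ⟩
      F q + q * F q                             ≈⟨ +-congʳ (F-unfold q) ⟩
      1# + q * q * H q + q * F q                ≈⟨ solve 2 (λ x y → con 1 :+ x :+ y := con 1 :+ (y :+ x)) refl (q * q * H q) (q * F q) ⟩
      1# + (q * F q + q * q * H q)              ≈⟨ +-congˡ (+-cong (Σ-* q _) (Σ-* (q * q) _)) ⟨
      1# + (Σ (λ i → q * (q ^ i * A i)) + Σ (λ i → q * q * (q ^ i * A (suc i))))  ≈⟨ +-congˡ (Σ-+ _ _) ⟨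
      1# + Σ largestPart                        ≈⟨ partial-sums A largestPart step m ⟩
      A m + q ^ m * Σ (λ i → largestPart (i ℕ.+ m)) ∎
      where
      step : ∀ i → A (suc i) ≈ A i + q ^ i * largestPart i
      step i = begin
        A (suc i)                                        ≈⟨ A-suc i ⟩
        A i * (1# + o i) + q * o i * A (suc i)           ≈⟨ solve 4 (λ a o q b → a :* (con 1 :+ o) :+ q :* o :* b := a :+ o :* (a :+ q :* b)) refl (A i) (o i) q (A (suc i)) ⟩
        A i + o i * (A i + q * A (suc i))                ≈⟨ +-congˡ (*-congʳ (o-split i)) ⟩
        A i + q ^ i * (q * q ^ i) * (A i + q * A (suc i)) ≈⟨ solve 4 (λ a q p b → a :+ p :* (q :* p) :* (a :+ q :* b) := a :+ p :* (q :* (p :* a) :+ q :* q :* (p :* b))) refl (A i) q (q ^ i) (A (suc i)) ⟩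
        A i + q ^ i * largestPart i                      ∎

    -- The series behind the truncated sums and their recurrence

    -- E k * (1 - o k) is the k-th term of Gauss's series up to sign, and U k is
    -- the series T_{k+1} of the header.
    E : ℕ → Carrier
    E k = q ^ (k ℕ.* (2 ℕ.* k ℕ.+ 1))

    -- T_{k+1} of the header without its leading power of q. Here `A k * (1# + o k)` is A_{k+1} (1 -
    -- q^(2k+2)), and q^(2(k+2)i) is split into qⁱ, supplied by `Σ`, and `o (suc k) ^ i`.
    V : ℕ → Carrier
    V k = A k * (1# + o k) * Σ (λ i → o (suc k) ^ i * (A i * D (i ℕ.+ k)))

    U : ℕ → Carrier
    U k = E (suc k) * V k

    -- The term i = 0 is `A k * (1# + o k) * D k`, which is `A (suc k)` by definition. It is kept
    -- apart both for the pairing in `V-recurrence` and for positivity.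
    V-split : ∀ k → V k ≈ A (suc k) + q * (o (suc k) * (A k * (1# + o k) * Σ (λ i → o (suc k) ^ i * (A (suc i) * D (suc i ℕ.+ k)))))
    V-split k = begin
      L * Σ (λ i → c ^ i * (A i * D (i ℕ.+ k)))         ≈⟨ *-congˡ (Σ-unfold _) ⟩
      L * (1# * (1# * D k) + q * Σ (λ i → c * c ^ i * (A (suc i) * D (suc i ℕ.+ k))))  ≈⟨ *-congˡ (+-congˡ (*-congˡ (trans (Σ-cong (λ i → *-assoc c _ _)) (Σ-* c _)))) ⟩
      L * (1# * (1# * D k) + q * (c * s))               ≈⟨ solve 5 (λ l d q c s → l :* (con 1 :* (con 1 :* d) :+ q :* (c :* s)) := l :* d :+ q :* (c :* (l :* s))) refl L (D k) q c s ⟩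
      L * D k + q * (c * (L * s))                       ∎
      where
      L c s : Carrier
      L = A k * (1# + o k)
      c = o (suc k)
      s = Σ (λ i → c ^ i * (A (suc i) * D (suc i ℕ.+ k)))

    -- The summands of V k and V (suc k) that share the factor
    -- d = 1 / (1 - q^(2(i+k+2))): it cancels in their sum.
    merge : ∀ {a b c x y w l d} →
            x ≈ l + a * x → y ≈ w * (1# + b) + q * b * y → d ≈ 1# + a * b * q * d → c ≈ q * a →
            l * (y * d) + a * b * (x * (1# + c) * (w * d)) + a * (x * w) ≈ x * y
    merge {a} {b} {c} {x} {y} {w} {l} {d} x≈ y≈ d≈ c≈ = +-cancelˡ (a * x * (y * d)) _ _ (begin
      -- The added term completes `l` to `l + a * x`, which is `x`; the equation of `d` is then used
      -- once in each direction.
      a * x * (y * d) + (l * (y * d) + a * b * (x * (1# + c) * (w * d)) + a * (x * w))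
        ≈⟨ +-congˡ (+-congʳ (+-congˡ (*-congˡ (*-congʳ (*-congˡ (+-congˡ c≈)))))) ⟩
      a * x * (y * d) + (l * (y * d) + a * b * (x * (1# + q * a) * (w * d)) + a * (x * w))
        ≈⟨ solve 8 (λ a b q x y w l d →
             a :* x :* (y :* d) :+ (l :* (y :* d) :+ a :* b :* (x :* (con 1 :+ q :* a) :* (w :* d)) :+ a :* (x :* w)) :=
             (l :+ a :* x) :* (y :* d) :+ a :* x :* w :* (b :* d) :+ a :* x :* w :* (con 1 :+ a :* b :* q :* d))
           refl a b q x y w l d ⟩
      (l + a * x) * (y * d) + a * x * w * (b * d) + a * x * w * (1# + a * b * q * d)
        ≈⟨ +-cong (+-congʳ (*-congʳ x≈)) (*-congˡ d≈) ⟨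
      x * (y * d) + a * x * w * (b * d) + a * x * w * d
        ≈⟨ solve 6 (λ a b x y w d → x :* (y :* d) :+ a :* x :* w :* (b :* d) :+ a :* x :* w :* d := x :* y :* d :+ a :* x :* d :* (w :* (con 1 :+ b))) refl a b x y w d ⟩
      x * y * d + a * x * d * (w * (1# + b))
        ≈⟨ +-congʳ (*-congˡ d≈) ⟩
      x * y * (1# + a * b * q * d) + a * x * d * (w * (1# + b))
        ≈⟨ solve 7 (λ a b q x y w d → x :* y :* (con 1 :+ a :* b :* q :* d) :+ a :* x :* d :* (w :* (con 1 :+ b)) :=
             a :* x :* (d :* (w :* (con 1 :+ b) :+ q :* b :* y)) :+ x :* y) refl a b q x y w d ⟩
      a * x * (d * (w * (1# + b) + q * b * y)) + x * y
        ≈⟨ +-congʳ (*-congˡ (*-congˡ y≈)) ⟨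
      a * x * (d * y) + x * y
        ≈⟨ +-congʳ (*-congˡ (*-comm d y)) ⟩
      a * x * (y * d) + x * y ∎)

    -- The identity for T_{k+1} + T_{k+2} with `E (suc k)` divided out; `A (suc k) * F c` is P / (1
    -- + c) by `factorisation`. The term i + 1 of `V k` and the term i of `V (suc k)` have the same
    -- denominator, so `merge` applies to them.
    V-recurrence : ∀ k → let c = o (suc k) in
      V k + q * c * c * V (suc k) + c * c * (A (suc k) * F c) ≈ A (suc k) * F c
    V-recurrence k = begin
      V k + q * c * c * (x * (1# + c) * s₂) + c * c * (x * F c)
        -- All three series are brought to the shape `q * (c * Σ (λ i → c ^ i * _))` so that they
        -- can be merged under one `Σ`; `x` is the term i = 0 of `V k`.
        ≈⟨ +-cong (+-cong (V-split k) second) third ⟩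
      x + q * (c * (L * s₁)) + q * (c * Σ (λ i → c ^ i * g i)) + q * (c * Σ (λ i → c ^ i * h i))
        ≈⟨ +-congʳ (+-congʳ (+-congˡ (*-congˡ (*-congˡ first)))) ⟩
      x + q * (c * Σ (λ i → c ^ i * f i)) + q * (c * Σ (λ i → c ^ i * g i)) + q * (c * Σ (λ i → c ^ i * h i))
        ≈⟨ solve 6 (λ x q c f g h → x :+ q :* (c :* f) :+ q :* (c :* g) :+ q :* (c :* h) := x :+ q :* (c :* (f :+ g :+ h))) refl x q c _ _ _ ⟩
      x + q * (c * (Σ (λ i → c ^ i * f i) + Σ (λ i → c ^ i * g i) + Σ (λ i → c ^ i * h i)))
        ≈⟨ +-congˡ (*-congˡ (*-congˡ (trans (Σ-+ _ _) (+-congʳ (Σ-+ _ _))))) ⟨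
      x + q * (c * Σ (λ i → c ^ i * f i + c ^ i * g i + c ^ i * h i))
        ≈⟨ +-congˡ (*-congˡ (*-congˡ (Σ-cong merged))) ⟩
      x + q * (c * Σ (λ i → x * (c ^ i * A (suc i))))
        ≈⟨ +-congˡ (*-congˡ (*-congˡ (Σ-* x _))) ⟩
      x + q * (c * (x * H c))
        ≈⟨ solve 4 (λ x q c h → x :+ q :* (c :* (x :* h)) := x :* (con 1 :+ q :* c :* h)) refl x q c (H c) ⟩
      x * (1# + q * c * H c)
        ≈⟨ *-congˡ (F-unfold c) ⟨
      x * F c ∎
      where
      a c x L s₁ s₂ : Carrier
      a = q * o k
      c = o (suc k)
      x = A (suc k)
      L = A k * (1# + o k)
      s₁ = Σ (λ i → c ^ i * (A (suc i) * D (suc i ℕ.+ k)))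
      s₂ = Σ (λ i → (q * q * c) ^ i * (A i * D (i ℕ.+ suc k)))
      f g h : ℕ → Carrier
      f i = L * (A (suc i) * D (suc i ℕ.+ k))
      g i = a * o i * (x * (1# + c) * (A i * D (suc i ℕ.+ k)))
      h i = a * (x * A i)
      c≈ : c ≈ q * a
      c≈ = *-assoc q q (o k)
      first : L * s₁ ≈ Σ (λ i → c ^ i * f i)
      first = begin
        L * s₁   ≈⟨ Σ-* L _ ⟨
        _        ≈⟨ Σ-cong (λ i → solve 3 (λ l p y → l :* (p :* y) := p :* (l :* y)) refl L (c ^ i) (A (suc i) * D (suc i ℕ.+ k))) ⟩
        Σ (λ i → c ^ i * f i) ∎
      second : q * c * c * (x * (1# + c) * s₂) ≈ q * (c * Σ (λ i → c ^ i * g i))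
      second = begin
        q * c * c * (x * (1# + c) * s₂)
          ≈⟨ solve 5 (λ q c x e s → q :* c :* c :* (x :* e :* s) := q :* (c :* (c :* (x :* e) :* s))) refl q c x (1# + c) s₂ ⟩
        q * (c * (c * (x * (1# + c)) * s₂))
          ≈⟨ *-congˡ (*-congˡ (trans (sym (Σ-* _ _)) (Σ-cong term))) ⟩
        q * (c * Σ (λ i → c ^ i * g i)) ∎
        where
        term : ∀ i → c * (x * (1# + c)) * ((q * q * c) ^ i * (A i * D (i ℕ.+ suc k))) ≈ c ^ i * g i
        term i = begin
          c * (x * (1# + c)) * ((q * q * c) ^ i * (A i * D (i ℕ.+ suc k)))
            ≈⟨ *-cong (*-congʳ c≈) (*-congˡ (*-congˡ (reflexive (≡.cong D (ℕ.+-suc i k))))) ⟩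
          q * a * (x * (1# + c)) * ((q * q * c) ^ i * (A i * D (suc i ℕ.+ k)))
            ≈⟨ solve 5 (λ q a y p z → q :* a :* y :* (p :* z) := a :* (q :* p) :* (y :* z)) refl q a (x * (1# + c)) _ _ ⟩
          a * (q * (q * q * c) ^ i) * (x * (1# + c) * (A i * D (suc i ℕ.+ k)))
            ≈⟨ *-congʳ (*-congˡ (^-o c i)) ⟨
          a * (c ^ i * o i) * (x * (1# + c) * (A i * D (suc i ℕ.+ k)))
            ≈⟨ solve 4 (λ a p o z → a :* (p :* o) :* z := p :* (a :* o :* z)) refl a (c ^ i) (o i) _ ⟩
          c ^ i * g i ∎
      third : c * c * (x * F c) ≈ q * (c * Σ (λ i → c ^ i * h i))
      third = begin
        c * c * (x * F c)            ≈⟨ *-congʳ (*-congˡ c≈) ⟩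
        c * (q * a) * (x * F c)      ≈⟨ solve 5 (λ c q a x f → c :* (q :* a) :* (x :* f) := q :* (c :* (a :* x :* f))) refl c q a x (F c) ⟩
        q * (c * (a * x * F c))      ≈⟨ *-congˡ (*-congˡ (trans (sym (Σ-* _ _)) (Σ-cong (λ i → solve 4 (λ a x p y → a :* x :* (p :* y) := p :* (a :* (x :* y))) refl a x (c ^ i) (A i))))) ⟩
        q * (c * Σ (λ i → c ^ i * h i)) ∎
      merged : ∀ i → c ^ i * f i + c ^ i * g i + c ^ i * h i ≈ x * (c ^ i * A (suc i))
      merged i = begin
        c ^ i * f i + c ^ i * g i + c ^ i * h i
          ≈⟨ solve 4 (λ p f g h → p :* f :+ p :* g :+ p :* h := p :* (f :+ g :+ h)) refl (c ^ i) (f i) (g i) (h i) ⟩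
        c ^ i * (f i + g i + h i)
          ≈⟨ *-congˡ (merge (A-suc k) (A-suc i) d≈ c≈) ⟩
        c ^ i * (x * A (suc i))
          ≈⟨ solve 3 (λ p x y → p :* (x :* y) := x :* (p :* y)) refl (c ^ i) x (A (suc i)) ⟩
        x * (c ^ i * A (suc i)) ∎
        where
        d≈ : D (suc i ℕ.+ k) ≈ 1# + a * o i * q * D (suc i ℕ.+ k)
        d≈ = begin
          D (suc i ℕ.+ k)  ≈⟨ geom-unfold _ ⟩
          1# + q * o (suc (i ℕ.+ k)) * D (suc i ℕ.+ k) ≈⟨ +-congˡ (*-congʳ (trans (*-congˡ (o-+ i k)) (*-comm q _))) ⟩
          1# + a * o i * q * D (suc i ℕ.+ k) ∎

    E-suc : ∀ k → E (suc k) ≈ E k * (q * o k * o k)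
    E-suc k = begin
      E (suc k) ≡⟨ ≡.cong (q ^_) exponent ⟩
      q ^ (k ℕ.* m ℕ.+ (suc m ℕ.+ m)) ≈⟨ ^-homo-* q (k ℕ.* m) _ ⟩
      E k * q ^ (suc m ℕ.+ m) ≈⟨ *-congˡ (^-homo-* q (suc m) m) ⟩
      E k * (q * q ^ m * q ^ m) ≈⟨ *-congˡ (*-cong (*-congˡ (o-^ k)) (o-^ k)) ⟨
      E k * (q * o k * o k) ∎
      where
      open ℕSolver.+-*-Solver using () renaming (solve to solveℕ; _:+_ to _⊞_; _:*_ to _⊠_; _:=_ to _≐_; con to conℕ)
      m : ℕ
      m = 2 ℕ.* k ℕ.+ 1
      exponent : suc k ℕ.* (2 ℕ.* suc k ℕ.+ 1) ≡ k ℕ.* m ℕ.+ (suc m ℕ.+ m)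
      exponent = solveℕ 1 (λ k → (conℕ 1 ⊞ k) ⊠ (conℕ 2 ⊠ (conℕ 1 ⊞ k) ⊞ conℕ 1) ≐
                   k ⊠ (conℕ 2 ⊠ k ⊞ conℕ 1) ⊞ (conℕ 1 ⊞ (conℕ 2 ⊠ k ⊞ conℕ 1) ⊞ (conℕ 2 ⊠ k ⊞ conℕ 1))) ≡.refl k

    -- Up to sign, each summand of index at least 1 is thus the sum of two consecutive `U`, which
    -- makes the alternating sum telescope.
    U-recurrence : ∀ k → U k + U (suc k) + E (suc k) * o (suc k) * P ≈ E (suc k) * P
    U-recurrence k = begin
      e * V k + E (suc (suc k)) * V (suc k) + e * c * P
        ≈⟨ +-cong (+-congˡ (*-congʳ (E-suc (suc k)))) (*-congˡ (sym (factorisation (suc k)))) ⟩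
      e * V k + e * (q * c * c) * V (suc k) + e * c * (x * (1# + c) * F c)
        ≈⟨ solve 7 (λ e q c v v′ x f → e :* v :+ e :* (q :* c :* c) :* v′ :+ e :* c :* (x :* (con 1 :+ c) :* f) :=
             e :* (v :+ q :* c :* c :* v′ :+ c :* c :* (x :* f)) :+ e :* c :* (x :* f)) refl e q c (V k) (V (suc k)) x (F c) ⟩
      e * (V k + q * c * c * V (suc k) + c * c * (x * F c)) + e * c * (x * F c)
        ≈⟨ +-congʳ (*-congˡ (V-recurrence k)) ⟩
      e * (x * F c) + e * c * (x * F c)
        ≈⟨ solve 4 (λ e c x f → e :* (x :* f) :+ e :* c :* (x :* f) := e :* (x :* (con 1 :+ c) :* f)) refl e c x (F c) ⟩
      e * (x * (1# + c) * F c)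
        ≈⟨ *-congˡ (factorisation (suc k)) ⟩
      e * P ∎
      where
      e c x : Carrier
      e = E (suc k)
      c = o (suc k)
      x = A (suc k)

    -- The start of the telescoping, obtained by inserting `A-increment` into `H q`. The extra `1#`
    -- is the constant term of (1 - q) P and the reason for n ≥ 1 in the theorem.
    U-initial : U 0 + 1# + q * P ≈ P
    U-initial = begin
      U 0 + 1# + q * P
        -- `E 1` appears unfolded as q³, and `V 0` as 1 · (1 + q) · s.
        ≈⟨ solve 3 (λ q s f → q :* (q :* (q :* con 1)) :* (con 1 :* (con 1 :+ q) :* s) :+ con 1 :+ q :* ((con 1 :+ q) :* f) :=
             con 1 :+ q :* q :* (f :+ (con 1 :+ q) :* (q :* s)) :+ q :* f) refl q s (F q) ⟩
      1# + q * q * (F q + (1# + q) * (q * s)) + q * F q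
        ≈⟨ +-congʳ (+-congˡ (*-congˡ Hq)) ⟨
      1# + q * q * H q + q * F q
        ≈⟨ +-congʳ (F-unfold q) ⟨
      F q + q * F q
        ≈⟨ solve 2 (λ q f → f :+ q :* f := (con 1 :+ q) :* f) refl q (F q) ⟩
      P ∎
      where
      s : Carrier
      s = Σ (λ i → (q * q * q) ^ i * (A i * D (i ℕ.+ 0)))
      Hq : H q ≈ F q + (1# + q) * (q * s)
      Hq = begin
        H q ≈⟨ Σ-cong term ⟩
        Σ (λ i → q ^ i * A i + (1# + q) * (q * ((q * q * q) ^ i * (A i * D (i ℕ.+ 0))))) ≈⟨ Σ-+ _ _ ⟩
        F q + _ ≈⟨ +-congˡ (trans (Σ-* _ _) (*-congˡ (Σ-* _ _))) ⟩
        F q + (1# + q) * (q * s) ∎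
        where
        term : ∀ i → q ^ i * A (suc i) ≈ q ^ i * A i + (1# + q) * (q * ((q * q * q) ^ i * (A i * D (i ℕ.+ 0))))
        term i = begin
          q ^ i * A (suc i)
            ≈⟨ *-congˡ (A-increment i) ⟩
          q ^ i * (A i + (1# + q) * (o i * (A i * D i)))
            ≈⟨ solve 5 (λ p a e o z → p :* (a :+ e :* (o :* z)) := p :* a :+ e :* (p :* o :* z)) refl (q ^ i) (A i) (1# + q) (o i) (A i * D i) ⟩
          q ^ i * A i + (1# + q) * (q ^ i * o i * (A i * D i))
            ≈⟨ +-congˡ (*-congˡ (*-cong (^-o q i) (*-congˡ (reflexive (≡.cong D (≡.sym (ℕ.+-identityʳ i))))))) ⟩
          q ^ i * A i + (1# + q) * (q * (q * q * q) ^ i * (A i * D (i ℕ.+ 0)))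
            ≈⟨ +-congˡ (*-congˡ (*-assoc q _ _)) ⟩
          q ^ i * A i + (1# + q) * (q * ((q * q * q) ^ i * (A i * D (i ℕ.+ 0)))) ∎

-- Recursion on the largest part in the enumeration of pod partitions

module Counting where

  open import Data.Nat using (_≤_; _<_; _≥_)
  open ≡ using (refl; sym; trans; cong; subst; _≢_; module ≡-Reasoning)

  private variable
    B : Set
    m n : ℕ
    p : List ℕ

  length-filter-cong : {P Q : B → Set} (P? : Decidable P) (Q? : Decidable Q) {xs : List B} →
                       All (λ x → P x ⇔ Q x) xs →
                       length (filter P? xs) ≡ length (filter Q? xs)
  length-filter-cong P? Q? []                  = refl
  length-filter-cong P? Q? (_∷_ {x} e es) with P? x | Q? x
  ... | yes _ | yes _ = cong suc (length-filter-cong P? Q? es)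
  ... | no  _ | no  _ = length-filter-cong P? Q? es
  ... | yes p | no ¬q = contradiction (Equivalence.to e p) ¬q
  ... | no ¬p | yes q = contradiction (Equivalence.from e q) ¬p

  length-filter-map : {P : B → Set} (P? : Decidable P) (f : B → B) (xs : List B) →
                      length (filter P? (map f xs)) ≡ length (filter (P? ∘ f) xs)
  length-filter-map P? f []       = refl
  length-filter-map P? f (x ∷ xs) with does (P? (f x))
  ... | true  = cong suc (length-filter-map P? f xs)
  ... | false = length-filter-map P? f xs

  count : ℕ → ℕ → ℕ → ℕ
  count l m n = length (filter (isPodPartition? n) (descending l m))

  -- Serves the second half of `descending`: the head `m` is moved from the lists into the
  -- predicate.
  countPrefixed : ℕ → ℕ → ℕ → ℕ
  countPrefixed l m n = length (filter (isPodPartition? n ∘ (m ∷_)) (descending l m))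

  count-suc : ∀ l m n → count (suc l) (suc m) n ≡ count (suc l) m n ℕ.+ countPrefixed l (suc m) n
  count-suc l m n = begin
    length (filter P? (ds ++ map (suc m ∷_) ps))                   ≡⟨ cong length (filter-++ P? ds _) ⟩
    length (filter P? ds ++ filter P? (map (suc m ∷_) ps))         ≡⟨ length-++ (filter P? ds) ⟩
    count (suc l) m n ℕ.+ length (filter P? (map (suc m ∷_) ps))   ≡⟨ cong (count (suc l) m n ℕ.+_) (length-filter-map P? (suc m ∷_) ps) ⟩
    count (suc l) m n ℕ.+ countPrefixed l (suc m) n                ∎
    where
    open ≡-Reasoning
    P? = isPodPartition? n
    ds = descending (suc l) m
    ps = descending l (suc m)

  countPrefixed-< : ∀ l → n < m → countPrefixed l m n ≡ 0
  countPrefixed-< {n} {m} l n<m = cong length (filter-none (isPodPartition? n ∘ (m ∷_)) (All.tabulate {xs = descending l m} λ {p} _ → oversized p))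
    where
    oversized : ∀ p → ¬ IsPodPartition n (m ∷ p)
    oversized p π = ℕ.<⇒≱ n<m (ℕ.≤-trans (ℕ.m≤m+n m _) (ℕ.≤-reflexive (IsPodPartition.total π)))

  -- `filter odd?` drops an even head, so the distinctness condition is the same for both lists.
  even-∷ : ¬ Odd (suc m) → Linked _≥_ (suc m ∷ p) →
           IsPodPartition (suc m ℕ.+ n) (suc m ∷ p) ⇔ IsPodPartition n p
  even-∷ {m} {p} ¬odd d = mk⇔
    (λ { (mkIsPodPartition (mkIsPartition (_ ∷ ps) d t) u) → mkIsPodPartition
           (mkIsPartition ps (Linked.tail d) (ℕ.+-cancelˡ-≡ (suc m) _ _ t))
           (subst Unique (filter-reject odd? {xs = p} ¬odd) u) })
    (λ { (mkIsPodPartition (mkIsPartition ps _ t) u) → mkIsPodPartition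
           (mkIsPartition (s≤s z≤n ∷ ps) d (cong (suc m ℕ.+_) t))
           (subst Unique (sym (filter-reject odd? {xs = p} ¬odd)) u) })

  -- The bound `m`, one below the head, ensures that the odd head does not recur in the tail.
  odd-∷ : Odd (suc m) → Linked _≥_ (m ∷ p) →
          IsPodPartition (suc m ℕ.+ n) (suc m ∷ p) ⇔ IsPodPartition n p
  odd-∷ {m} {p} odd d = mk⇔
    (λ { (mkIsPodPartition (mkIsPartition (_ ∷ ps) d t) u) → mkIsPodPartition
           (mkIsPartition ps (Linked.tail d) (ℕ.+-cancelˡ-≡ (suc m) _ _ t))
           (unique-tail (subst Unique (filter-accept odd? {xs = p} odd) u)) })
    (λ { (mkIsPodPartition (mkIsPartition ps _ t) u) → mkIsPodPartition
           (mkIsPartition (s≤s z≤n ∷ ps) (widen d) (cong (suc m ℕ.+_) t))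
           (subst Unique (sym (filter-accept odd? {xs = p} odd)) (fresh ∷ u)) })
    where
    unique-tail : ∀ {x xs} → Unique {A = ℕ} (x ∷ xs) → Unique xs
    unique-tail (_ ∷ u) = u
    widen : ∀ {p} → Linked _≥_ (m ∷ p) → Linked _≥_ (suc m ∷ p)
    widen [-]     = [-]
    widen (r ∷ d) = ℕ.m≤n⇒m≤1+n r ∷ d
    fresh : All (suc m ≢_) (filter odd? p)
    fresh = All.filter⁺ odd? (All.map (λ x≤m eq → ℕ.<⇒≢ (s≤s x≤m) (sym eq))
              (All.tail (Linked⇒All (λ y≤x z≤y → ℕ.≤-trans z≤y y≤x) (ℕ.≤-refl {m}) d)))

  countPrefixed-even : ∀ l n → ¬ Odd (suc m) → countPrefixed l (suc m) (suc m ℕ.+ n) ≡ count l (suc m) n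
  countPrefixed-even {m} l n ¬odd = length-filter-cong _ _
    (All.tabulate λ {p} p∈ → even-∷ ¬odd (∈-descending⁻ l (suc m) p∈))

  -- The bound drops to `m`: lists beginning with a second `suc m` repeat an odd part and are all
  -- rejected.
  countPrefixed-odd : ∀ l n → Odd (suc m) → countPrefixed l (suc m) (suc m ℕ.+ n) ≡ count l m n
  countPrefixed-odd {m} zero    n odd = length-filter-cong
    (isPodPartition? (suc m ℕ.+ n) ∘ (suc m ∷_)) (isPodPartition? n) (odd-∷ odd [-] ∷ [])
  countPrefixed-odd {m} (suc l) n odd = begin
    length (filter P? (ds ++ map (suc m ∷_) ps))                           ≡⟨ cong length (filter-++ P? ds _) ⟩
    length (filter P? ds ++ filter P? (map (suc m ∷_) ps))                 ≡⟨ cong (λ xs → length (filter P? ds ++ xs)) (filter-none P? (All.map⁺ {xs = ps} (All.tabulate λ {p} _ → repeated p))) ⟩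
    length (filter P? ds ++ [])                                            ≡⟨ length-++ (filter P? ds) ⟩
    length (filter P? ds) ℕ.+ 0                                            ≡⟨ ℕ.+-identityʳ _ ⟩
    length (filter P? ds)                                                  ≡⟨ length-filter-cong P? (isPodPartition? n) (All.tabulate λ p∈ → odd-∷ odd (∈-descending⁻ (suc l) m p∈)) ⟩
    count (suc l) m n                                                      ∎
    where
    open ≡-Reasoning
    P? = isPodPartition? (suc m ℕ.+ n) ∘ (suc m ∷_)
    ds = descending (suc l) m
    ps = descending l (suc m)
    repeated : ∀ p → ¬ IsPodPartition (suc m ℕ.+ n) (suc m ∷ suc m ∷ p)
    repeated p π with subst Unique (trans (filter-accept odd? odd) (cong (suc m ∷_) (filter-accept odd? {xs = p} odd)))
                        (IsPodPartition.oddDistinct π)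
    ... | (x≢x ∷ _) ∷ _ = x≢x refl

  -- Raising the bound past n only adds lists whose head is too large, and `countPrefixed-<` counts
  -- none of these.
  count-stable : ∀ l → n ≤ m → count l m n ≡ count l n n
  count-stable {n} l n≤m = go (ℕ.≤⇒≤′ n≤m)
    where
    go : ∀ {m} → n ℕ.≤′ m → count l m n ≡ count l n n
    go ℕ.≤′-refl           = refl
    go (ℕ.≤′-step n≤′m) = trans (step l (ℕ.≤′⇒≤ n≤′m)) (go n≤′m)
      where
      step : ∀ l {m} → n ≤ m → count l (suc m) n ≡ count l m n
      step zero    _       = refl
      step (suc l) {m} n≤m = trans (count-suc l m n)
        (trans (cong (count (suc l) m n ℕ.+_) (countPrefixed-< l (s≤s n≤m))) (ℕ.+-identityʳ _))

-- The semiring of formal power series over ℕ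

module PodSeries where

  open import Data.Nat using (_≤_; _<_)
  open Counting

  Series : Set
  Series = ℕ → ℕ

  infixl 7 _⊗_
  -- The Cauchy product, by structural recursion on the degree through f = f 0 + q · (`f ∘ suc`).
  _⊗_ : Series → Series → Series
  (f ⊗ g) zero    = f 0 ℕ.* g 0
  (f ⊗ g) (suc n) = f 0 ℕ.* g (suc n) ℕ.+ (f ∘ suc ⊗ g) n

  one : Series
  one zero    = 1
  one (suc _) = 0

  X : Series
  X zero    = 0
  X (suc n) = one n

  private module Coefficientwise where
    open ≡ using (refl; sym; trans; cong; cong₂)
    open ≡.≡-Reasoning
    open ℕSolver.+-*-Solver

    +-commutativeMonoid : CommutativeMonoid 0ℓ 0ℓ
    +-commutativeMonoid = Pointwise.commutativeMonoid ℕ ℕ.+-0-commutativeMonoid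

    open CommutativeMonoid +-commutativeMonoid public
      using () renaming (_≈_ to _≗_; _∙_ to infixl 6 _⊕_; ε to nil; isEquivalence to ≗-isEquivalence; isCommutativeMonoid to ⊕-isCommutativeMonoid)

    ⊗-cong : ∀ {f f′ g g′} → f ≗ f′ → g ≗ g′ → f ⊗ g ≗ f′ ⊗ g′
    ⊗-cong f≗ g≗ zero    = cong₂ ℕ._*_ (f≗ 0) (g≗ 0)
    ⊗-cong f≗ g≗ (suc n) = cong₂ ℕ._+_ (cong₂ ℕ._*_ (f≗ 0) (g≗ (suc n))) (⊗-cong (f≗ ∘ suc) g≗ n)

    ⊗-zeroˡ : ∀ g → nil ⊗ g ≗ nil
    ⊗-zeroˡ g zero    = refl
    ⊗-zeroˡ g (suc n) = ⊗-zeroˡ g n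

    ⊗-identityˡ : ∀ g → one ⊗ g ≗ g
    ⊗-identityˡ g zero    = ℕ.+-identityʳ _
    ⊗-identityˡ g (suc n) = trans (cong₂ ℕ._+_ (ℕ.*-identityˡ _) (⊗-zeroˡ g n)) (ℕ.+-identityʳ _)

    ⊗-distribʳ : ∀ h f g → (f ⊕ g) ⊗ h ≗ f ⊗ h ⊕ g ⊗ h
    ⊗-distribʳ h f g zero    = ℕ.*-distribʳ-+ (h 0) (f 0) (g 0)
    ⊗-distribʳ h f g (suc n) = trans (cong (((f 0 ℕ.+ g 0) ℕ.* h (suc n)) ℕ.+_) (⊗-distribʳ h (f ∘ suc) (g ∘ suc) n))
      (solve 5 (λ a b c x y → (a :+ b) :* c :+ (x :+ y) := (a :* c :+ x) :+ (b :* c :+ y)) refl (f 0) (g 0) (h (suc n)) _ _)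

    -- The mirror image of the defining recursion, peeling off `g 0` instead of `f 0`; commutativity
    -- follows by comparing the two.
    ⊗-sucʳ : ∀ f g n → (f ⊗ g) (suc n) ≡ f (suc n) ℕ.* g 0 ℕ.+ (f ⊗ g ∘ suc) n
    ⊗-sucʳ f g zero    = ℕ.+-comm (f 0 ℕ.* g 1) _
    ⊗-sucʳ f g (suc n) = trans (cong (f 0 ℕ.* g (suc (suc n)) ℕ.+_) (⊗-sucʳ (f ∘ suc) g n))
      (solve 3 (λ a b c → a :+ (b :+ c) := b :+ (a :+ c)) refl (f 0 ℕ.* g (suc (suc n))) (f (suc (suc n)) ℕ.* g 0) _)

    ⊗-comm : ∀ f g → f ⊗ g ≗ g ⊗ f
    ⊗-comm f g zero    = ℕ.*-comm (f 0) (g 0)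
    ⊗-comm f g (suc n) = trans (cong₂ ℕ._+_ (ℕ.*-comm (f 0) (g (suc n))) (⊗-comm (f ∘ suc) g n)) (sym (⊗-sucʳ g f n))

    ⊗-scale : ∀ c f g → (λ n → c ℕ.* f n) ⊗ g ≗ (λ n → c ℕ.* (f ⊗ g) n)
    ⊗-scale c f g zero    = ℕ.*-assoc c (f 0) (g 0)
    ⊗-scale c f g (suc n) = trans (cong (c ℕ.* f 0 ℕ.* g (suc n) ℕ.+_) (⊗-scale c (f ∘ suc) g n))
      (solve 4 (λ c a b x → c :* a :* b :+ c :* x := c :* (a :* b :+ x)) refl c (f 0) (g (suc n)) _)

    ⊗-assoc : ∀ f g h → (f ⊗ g) ⊗ h ≗ f ⊗ (g ⊗ h)
    ⊗-assoc f g h zero    = ℕ.*-assoc (f 0) (g 0) (h 0)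
    ⊗-assoc f g h (suc n) = begin
      f 0 ℕ.* g 0 ℕ.* h (suc n) ℕ.+ (((λ m → f 0 ℕ.* g (suc m)) ⊕ (f ∘ suc ⊗ g)) ⊗ h) n
        ≡⟨ cong (f 0 ℕ.* g 0 ℕ.* h (suc n) ℕ.+_) (⊗-distribʳ h _ (f ∘ suc ⊗ g) n) ⟩
      f 0 ℕ.* g 0 ℕ.* h (suc n) ℕ.+ (((λ m → f 0 ℕ.* g (suc m)) ⊗ h) n ℕ.+ ((f ∘ suc ⊗ g) ⊗ h) n)
        ≡⟨ cong (f 0 ℕ.* g 0 ℕ.* h (suc n) ℕ.+_) (cong₂ ℕ._+_ (⊗-scale (f 0) (g ∘ suc) h n) (⊗-assoc (f ∘ suc) g h n)) ⟩
      f 0 ℕ.* g 0 ℕ.* h (suc n) ℕ.+ (f 0 ℕ.* (g ∘ suc ⊗ h) n ℕ.+ (f ∘ suc ⊗ (g ⊗ h)) n)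
        ≡⟨ solve 5 (λ a b c x y → a :* b :* c :+ (a :* x :+ y) := a :* (b :* c :+ x) :+ y) refl (f 0) (g 0) (h (suc n)) _ _ ⟩
      f 0 ℕ.* (g 0 ℕ.* h (suc n) ℕ.+ (g ∘ suc ⊗ h) n) ℕ.+ (f ∘ suc ⊗ (g ⊗ h)) n ∎

  series : CommutativeSemiring 0ℓ 0ℓ
  series = record
    { Carrier = Series
    ; isCommutativeSemiring = isCommutativeSemiringˡ (record
      { +-isCommutativeMonoid = ⊕-isCommutativeMonoid
      ; *-isCommutativeMonoid = isCommutativeMonoidˡ (record
        { isSemigroup = record
          { isMagma = record { isEquivalence = ≗-isEquivalence ; ∙-cong = ⊗-cong }
          ; assoc   = ⊗-assoc
          }
        ; identityˡ = ⊗-identityˡ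
        ; comm      = ⊗-comm
        })
      ; distribʳ = ⊗-distribʳ
      ; zeroˡ    = ⊗-zeroˡ
      })
    }
    where open Coefficientwise

  open CommutativeSemiring series using (_≈_; _+_; _*_; 1#; semiring; +-congˡ; *-congˡ; *-congʳ; *-assoc; *-identityˡ; sym; trans)
  open import Algebra.Properties.Semiring.Exp semiring using (_^_; ^-homo-*)

  X*-suc : ∀ f n → (X * f) (suc n) ≡ f n
  X*-suc f n = *-identityˡ f n

  -- Weighted sums of series

  -- weightedSum f is the series ∑ᵢ qⁱ f i.
  weightedSum : (ℕ → Series) → Series
  weightedSum f zero    = f 0 0
  weightedSum f (suc n) = f 0 (suc n) ℕ.+ weightedSum (f ∘ suc) n

  weightedSum-cong : ∀ {f g} → (∀ i → f i ≈ g i) → weightedSum f ≈ weightedSum g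
  weightedSum-cong f≈g zero    = f≈g 0 0
  weightedSum-cong f≈g (suc n) = ≡.cong₂ ℕ._+_ (f≈g 0 (suc n)) (weightedSum-cong (f≈g ∘ suc) n)

  weightedSum-unfold : ∀ f → weightedSum f ≈ f 0 + X * weightedSum (f ∘ suc)
  weightedSum-unfold f zero    = ≡.sym (ℕ.+-identityʳ _)
  weightedSum-unfold f (suc n) = ≡.cong (f 0 (suc n) ℕ.+_) (≡.sym (X*-suc _ n))

  weightedSum-+ : ∀ f g → weightedSum (λ i → f i + g i) ≈ weightedSum f + weightedSum g
  weightedSum-+ f g zero    = ≡.refl
  weightedSum-+ f g (suc n) = ≡.trans (≡.cong (f 0 (suc n) ℕ.+ g 0 (suc n) ℕ.+_) (weightedSum-+ (f ∘ suc) (g ∘ suc) n))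
    (solve 4 (λ a b c d → a :+ b :+ (c :+ d) := a :+ c :+ (b :+ d)) ≡.refl (f 0 (suc n)) (g 0 (suc n)) _ _)
    where open ℕSolver.+-*-Solver

  weightedSum-* : ∀ c f → weightedSum (λ i → c * f i) ≈ c * weightedSum f
  weightedSum-* c f zero    = ≡.refl
  weightedSum-* c f (suc n) = begin
    (c * f 0) (suc n) ℕ.+ weightedSum (λ i → c * f (suc i)) n     ≡⟨ ≡.cong ((c * f 0) (suc n) ℕ.+_) (weightedSum-* c (f ∘ suc) n) ⟩
    (c * f 0) (suc n) ℕ.+ (c * weightedSum (f ∘ suc)) n           ≡⟨ ≡.cong ((c * f 0) (suc n) ℕ.+_) (X*-suc _ n) ⟨
    (c * f 0 + X * (c * weightedSum (f ∘ suc))) (suc n)           ≡⟨ solve 4 (λ c f x s → c :* f :+ x :* (c :* s) := c :* (f :+ x :* s)) (λ _ → ≡.refl) c (f 0) X (weightedSum (f ∘ suc)) (suc n) ⟩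
    (c * (f 0 + X * weightedSum (f ∘ suc))) (suc n)               ≡⟨ *-congˡ {c} (weightedSum-unfold f) (suc n) ⟨
    (c * weightedSum f) (suc n)                                   ∎
    where
    open ≡.≡-Reasoning
    open SemiringSolver series using (solve; _:+_; _:*_; _:=_)

  open Truncation.WithSum series (λ f g h f+g≈f+h n → ℕ.+-cancelˡ-≡ (f n) (g n) (h n) (f+g≈f+h n))
    X weightedSum weightedSum-cong weightedSum-unfold weightedSum-+ weightedSum-*

  -- Agreement of the enumeration with the product

  X^*-< : ∀ m f {n} → n < m → (X ^ m * f) n ≡ 0
  X^*-< (suc m) f {zero}  _         = ≡.refl
  X^*-< (suc m) f {suc n} (s≤s n<m) = ≡.trans (*-assoc X (X ^ m) f (suc n)) (≡.trans (X*-suc _ n) (X^*-< m f n<m))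

  X^*-+ : ∀ m f n → (X ^ m * f) (m ℕ.+ n) ≡ f n
  X^*-+ zero    f n = *-identityˡ f n
  X^*-+ (suc m) f n = ≡.trans (*-assoc X (X ^ m) f (suc m ℕ.+ n)) (≡.trans (X*-suc _ (m ℕ.+ n)) (X^*-+ m f n))

  -- Limited to degrees up to m + l because enumerations with at most `l` parts are matched with
  -- their series only up to degree `l`.
  X^*-unique : ∀ m {l} {f g : Series} → (∀ {n} → n < m → g n ≡ 0) → (∀ {n} → n ≤ l → g (m ℕ.+ n) ≡ f n) →
               ∀ {n} → n ≤ m ℕ.+ l → g n ≡ (X ^ m * f) n
  X^*-unique m {l} {f} {g} below above {n} n≤m+l with n ℕ.<? m
  ... | yes n<m = ≡.trans (below n<m) (≡.sym (X^*-< m f n<m))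
  ... | no  n≮m = ≡.subst (λ k → g k ≡ (X ^ m * f) k) m+d≡n
                    (≡.trans (above (ℕ.+-cancelˡ-≤ m _ _ (≡.subst (_≤ m ℕ.+ l) (≡.sym m+d≡n) n≤m+l)))
                             (≡.sym (X^*-+ m f (n ℕ.∸ m))))
    where
    m+d≡n : m ℕ.+ (n ℕ.∸ m) ≡ n
    m+d≡n = ℕ.m+[n∸m]≡n (ℕ.≮⇒≥ n≮m)

  -- The exponent contains `i * 2` because `suc i * 2` reduces to two successors, the shape that the
  -- recursion of `descending` consumes.
  o≈X^ : ∀ i → o i ≈ X ^ suc (i ℕ.* 2)
  o≈X^ i n = ≡.trans (o-^ i n) (≡.cong (λ m → (X ^ m) n) (≡.trans (ℕ.+-comm _ 1) (≡.cong suc (ℕ.*-comm 2 i))))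

  o-constant : ∀ i → o i 0 ≡ 0
  o-constant zero    = ≡.refl
  o-constant (suc i) = ≡.refl

  A-constant : ∀ i → A i 0 ≡ 1
  A-constant zero    = ≡.refl
  A-constant (suc i) = ≡.cong₂ (λ a b → a ℕ.* suc b ℕ.* 1) (A-constant i) (o-constant i)

  even-number : ∀ i → ¬ Odd (suc i ℕ.* 2)
  even-number i odd = odd (n∣m*n (suc i))

  odd-number : ∀ i → Odd (suc (i ℕ.* 2))
  odd-number i 2∣1+2i with ∣1⇒≡1 (∣m+n∣m⇒∣n (≡.subst (2 ∣_) (ℕ.+-comm 1 _) 2∣1+2i) (n∣m*n i))
  ... | ()

  -- Induction on the largest allowed part. The part 2i+2 may repeat, which reproduces `A-suc`; the
  -- part 2i+1 occurs at most once, which gives the factor 1 + `o i`. For n ≤ l the length bound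
  -- excludes no partition of n.
  count-even : ∀ l i {n} → n ≤ l → count l (i ℕ.* 2) n ≡ A i n
  count-odd  : ∀ l i {n} → n ≤ l → count l (suc (i ℕ.* 2)) n ≡ (A i * (1# + o i)) n

  count-even zero    i       z≤n         = ≡.sym (A-constant i)
  count-even (suc l) zero    {zero}  _   = ≡.refl
  count-even (suc l) zero    {suc n} _   = ≡.refl
  count-even (suc l) (suc i) {n} n≤1+l = begin
    count (suc l) m n                                    ≡⟨ count-suc l _ n ⟩
    count (suc l) (suc (i ℕ.* 2)) n ℕ.+ countPrefixed l m n ≡⟨ ≡.cong₂ ℕ._+_ (count-odd (suc l) i n≤1+l) prefixed ⟩
    (A i * (1# + o i) + X ^ m * A (suc i)) n             ≡⟨ +-congˡ {A i * (1# + o i)} (*-congʳ {A (suc i)} (*-congˡ {X} (o≈X^ i))) n ⟨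
    (A i * (1# + o i) + X * o i * A (suc i)) n           ≡⟨ A-suc i n ⟨
    A (suc i) n                                          ∎
    where
    open ≡.≡-Reasoning
    m : ℕ
    m = suc i ℕ.* 2
    prefixed : countPrefixed l m n ≡ (X ^ m * A (suc i)) n
    prefixed = X^*-unique m {g = countPrefixed l m} (countPrefixed-< l)
      (λ {k} k≤l → ≡.trans (countPrefixed-even l k (even-number i)) (count-even l (suc i) k≤l))
      -- `m` is positive, so n ≤ suc l implies n ≤ m + l.
      (ℕ.≤-trans n≤1+l (s≤s (ℕ.m≤n+m l _)))

  count-odd zero    i z≤n = ≡.sym (≡.cong₂ (λ a b → a ℕ.* suc b) (A-constant i) (o-constant i))
  count-odd (suc l) i {n} n≤1+l = begin
    count (suc l) m n                                    ≡⟨ count-suc l _ n ⟩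
    count (suc l) (i ℕ.* 2) n ℕ.+ countPrefixed l m n    ≡⟨ ≡.cong₂ ℕ._+_ (count-even (suc l) i n≤1+l) prefixed ⟩
    (A i + X ^ m * A i) n                                ≡⟨ +-congˡ {A i} (*-congʳ {A i} (o≈X^ i)) n ⟨
    (A i + o i * A i) n                                  ≡⟨ solve 2 (λ a o → a :+ o :* a := a :* (con 1 :+ o)) (λ _ → ≡.refl) (A i) (o i) n ⟩
    (A i * (1# + o i)) n                                 ∎
    where
    open ≡.≡-Reasoning
    open SemiringSolver series using (solve; _:+_; _:*_; _:=_; con)
    m : ℕ
    m = suc (i ℕ.* 2)
    prefixed : countPrefixed l m n ≡ (X ^ m * A i) n
    prefixed = X^*-unique m {g = countPrefixed l m} (countPrefixed-< l)
      (λ {k} k≤l → ≡.trans (countPrefixed-odd l k (odd-number i)) (count-even l i k≤l))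
      (ℕ.≤-trans n≤1+l (s≤s (ℕ.m≤n+m l _)))

  -- The remainder after `A (suc n)` starts at degree n + 1, and `count-stable` lowers the bound
  -- 2n+2 on the parts to n.
  P≗countPod : ∀ n → P n ≡ countPod n
  P≗countPod n = begin
    P n                                 ≡⟨ A-tends-to-P (suc n) n ⟩
    A (suc n) n ℕ.+ (X ^ suc n * _) n   ≡⟨ ≡.cong (A (suc n) n ℕ.+_) (X^*-< (suc n) _ ℕ.≤-refl) ⟩
    A (suc n) n ℕ.+ 0                   ≡⟨ ℕ.+-identityʳ _ ⟩
    A (suc n) n                         ≡⟨ count-even n (suc n) ℕ.≤-refl ⟨
    count n (suc n ℕ.* 2) n             ≡⟨ count-stable n (ℕ.≤-trans (ℕ.n≤1+n n) (ℕ.m≤m*n (suc n) 2)) ⟩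
    countPod n                          ∎
    where open ≡.≡-Reasoning

  -- The value 0 of `pod` at negative arguments matches the vanishing of `X ^ m * P` below degree m.
  pod-⊖ : ∀ m n → pod (n ⊖ m) ≡ + ((X ^ m * P) n)
  pod-⊖ zero    n       = ≡.cong +_ (≡.sym (≡.trans (*-identityˡ P n) (P≗countPod n)))
  pod-⊖ (suc m) zero    = ≡.cong +_ (≡.sym (X^*-< (suc m) P (s≤s z≤n)))
  pod-⊖ (suc m) (suc n) = begin
    pod (suc n ⊖ suc m)               ≡⟨ ≡.cong pod (ℤ.[1+m]⊖[1+n]≡m⊖n n m) ⟩
    pod (n ⊖ m)                       ≡⟨ pod-⊖ m n ⟩
    + ((X ^ m * P) n)                 ≡⟨ ≡.cong +_ (X*-suc (X ^ m * P) n) ⟨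
    + ((X * (X ^ m * P)) (suc n))     ≡⟨ ≡.cong +_ (*-assoc X (X ^ m) P (suc n)) ⟨
    + ((X ^ suc m * P) (suc n))       ∎
    where open ≡.≡-Reasoning

  pod-minus : ∀ n m → pod (+ n ℤ.- + m) ≡ + ((X ^ m * P) n)
  pod-minus n m = ≡.trans (≡.cong pod (ℤ.m-n≡m⊖n n m)) (pod-⊖ m n)

  -- Positivity of the coefficients

  -- `A 1` = (1 + q) / (1 - q²) = 1 / (1 - q) has all coefficients 1; the recursion goes down two
  -- degrees at a time.
  A₁-positive : ∀ n → 1 ≤ A 1 n
  A₁-positive n = ≡.subst (1 ≤_) (≡.sym (A-suc 0 n)) (go n)
    where
    go : ∀ n → 1 ≤ (A 0 * (1# + o 0) + X * o 0 * A 1) n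
    -- Degrees 0 and 1 come from the numerator 1 + q.
    go zero          = s≤s z≤n
    go (suc zero)    = s≤s z≤n
    go (suc (suc n)) = ℕ.≤-trans (≡.subst (1 ≤_) eq (A₁-positive n)) (ℕ.m≤n+m _ _)
      where
      eq : A 1 n ≡ (X * o 0 * A 1) (suc (suc n))
      eq = ≡.sym (≡.trans (*-assoc X X (A 1) (suc (suc n))) (≡.trans (X*-suc (X * A 1) (suc n)) (X*-suc (A 1) n)))

  -- By `A-increment` coefficients never decrease with the index. The index starts at 1 since `A 0`
  -- is the constant 1.
  A-positive : ∀ k n → 1 ≤ A (suc k) n
  A-positive zero    n = A₁-positive n
  A-positive (suc k) n = ≡.subst (1 ≤_) (≡.sym (A-increment (suc k) n)) (ℕ.≤-trans (A-positive k n) (ℕ.m≤m+n _ _))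

  V-positive : ∀ k n → 1 ≤ V k n
  V-positive k n = ≡.subst (1 ≤_) (≡.sym (V-split k n)) (ℕ.≤-trans (A-positive k n) (ℕ.m≤m+n _ _))

  U-positive : ∀ k {n} → suc k ℕ.* (2 ℕ.* suc k ℕ.+ 1) ≤ n → 1 ≤ U k n
  U-positive k {n} m≤n = ≡.subst (λ n → 1 ≤ U k n) (ℕ.m+[n∸m]≡n m≤n)
    (≡.subst (1 ≤_) (≡.sym (X^*-+ m (V k) (n ℕ.∸ m))) (V-positive k (n ℕ.∸ m)))
    where
    m : ℕ
    m = suc k ℕ.* (2 ℕ.* suc k ℕ.+ 1)

  -- Telescoping of the signed truncated sum

  summand : ℕ → ℕ → ℤ
  summand n j = -1ℤ ℤ.^ j ℤ.* (pod (+ n ℤ.- + (j ℕ.* (2 ℕ.* j ℕ.+ 1)))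
                      ℤ.- pod (+ n ℤ.- + ((j ℕ.+ 1) ℕ.* (2 ℕ.* j ℕ.+ 1))))

  -- The two arguments of `pod` differ by 2j+1, which is the exponent of `o j`.
  summand-coefficient : ∀ n j → summand n j ≡ -1ℤ ℤ.^ j ℤ.* (+ ((E j * P) n) ℤ.- + ((E j * o j * P) n))
  summand-coefficient n j = ≡.cong₂ (λ a b → -1ℤ ℤ.^ j ℤ.* (a ℤ.- b)) (pod-minus n (j ℕ.* m))
    (begin
      pod (+ n ℤ.- + ((j ℕ.+ 1) ℕ.* m))      ≡⟨ pod-minus n ((j ℕ.+ 1) ℕ.* m) ⟩
      + ((X ^ ((j ℕ.+ 1) ℕ.* m) * P) n)      ≡⟨ ≡.cong (λ e → + ((X ^ e * P) n)) exponent ⟩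
      + ((X ^ (j ℕ.* m ℕ.+ m) * P) n)        ≡⟨ ≡.cong +_ (*-congʳ {P} (trans {X ^ (j ℕ.* m ℕ.+ m)} (^-homo-* X (j ℕ.* m) m) (*-congˡ {E j} (sym {o j} (o-^ j)))) n) ⟩
      + ((E j * o j * P) n)                  ∎)
    where
    open ≡.≡-Reasoning
    m : ℕ
    m = 2 ℕ.* j ℕ.+ 1
    exponent : (j ℕ.+ 1) ℕ.* m ≡ j ℕ.* m ℕ.+ m
    exponent = ≡.trans (ℕ.*-distribʳ-+ m j 1) (≡.cong (j ℕ.* m ℕ.+_) (ℕ.*-identityˡ m))

  -- The sum over `Fin` unfolds at its first term, whereas the induction on k adds a last one.
  sum-snoc : ∀ (f : ℕ → ℤ) k → ∑[ i < suc k ] f (toℕ i) ≡ ∑[ i < k ] f (toℕ i) ℤ.+ f k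
  sum-snoc f k = ≡.trans (sum-init-last {k} (λ i → f (toℕ i)))
    (≡.cong₂ ℤ._+_ (sum-cong-≗ {k} (λ i → ≡.cong f (toℕ-inject₁ i))) (≡.cong f (toℕ-fromℕ k)))

  -- By `U-recurrence` the new summand is, up to sign, `U k` + `U (suc k)`; its sign is opposite to
  -- that of the previous sum, so `U k` cancels.
  truncated-sum : ∀ n k → ∑[ i < suc k ] summand (suc n) (toℕ i) ≡ -1ℤ ℤ.^ k ℤ.* + U k (suc n)
  truncated-sum n zero = begin
    summand (suc n) 0 ℤ.+ 0ℤ
      ≡⟨ ≡.cong (ℤ._+ 0ℤ) (summand-coefficient (suc n) 0) ⟩
    1ℤ ℤ.* (+ ((E 0 * P) (suc n)) ℤ.- + ((E 0 * o 0 * P) (suc n))) ℤ.+ 0ℤ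
      ≡⟨ ≡.cong₂ (λ a b → 1ℤ ℤ.* (+ a ℤ.- + b) ℤ.+ 0ℤ) (*-identityˡ P (suc n)) (*-congʳ {P} (*-identityˡ X) (suc n)) ⟩
    1ℤ ℤ.* (+ P (suc n) ℤ.- + (X * P) (suc n)) ℤ.+ 0ℤ
      -- At the positive degree `suc n` the series `1#` of `U-initial` contributes `0ℤ`.
      ≡⟨ ≡.cong (λ a → 1ℤ ℤ.* (+ a ℤ.- + (X * P) (suc n)) ℤ.+ 0ℤ) (U-initial (suc n)) ⟨
    1ℤ ℤ.* ((+ U 0 (suc n) ℤ.+ 0ℤ ℤ.+ + (X * P) (suc n)) ℤ.- + (X * P) (suc n)) ℤ.+ 0ℤ
      ≡⟨ solve 2 (λ u p → con 1ℤ :* ((u :+ con 0ℤ :+ p) :- p) :+ con 0ℤ := con 1ℤ :* u) ≡.refl (+ U 0 (suc n)) (+ (X * P) (suc n)) ⟩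
    1ℤ ℤ.* + U 0 (suc n) ∎
    where
    open ≡.≡-Reasoning
    open ℤSolver.+-*-Solver
  truncated-sum n (suc k) = begin
    ∑[ i < suc (suc k) ] summand (suc n) (toℕ i)
      ≡⟨ sum-snoc (summand (suc n)) (suc k) ⟩
    ∑[ i < suc k ] summand (suc n) (toℕ i) ℤ.+ summand (suc n) (suc k)
      ≡⟨ ≡.cong₂ ℤ._+_ (truncated-sum n k) (summand-coefficient (suc n) (suc k)) ⟩
    s ℤ.* u ℤ.+ -1ℤ ℤ.* s ℤ.* (+ ((E (suc k) * P) (suc n)) ℤ.- p)
      ≡⟨ ≡.cong (λ a → s ℤ.* u ℤ.+ -1ℤ ℤ.* s ℤ.* (+ a ℤ.- p)) (U-recurrence k (suc n)) ⟨
    s ℤ.* u ℤ.+ -1ℤ ℤ.* s ℤ.* (u ℤ.+ u′ ℤ.+ p ℤ.- p)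
      ≡⟨ solve 4 (λ s u u′ p → s :* u :+ con -1ℤ :* s :* (u :+ u′ :+ p :- p) := con -1ℤ :* s :* u′) ≡.refl s u u′ p ⟩
    -1ℤ ℤ.* s ℤ.* u′ ∎
    where
    open ≡.≡-Reasoning
    open ℤSolver.+-*-Solver
    s u u′ p : ℤ
    s = -1ℤ ℤ.^ k
    u = + U k (suc n)
    u′ = + U (suc k) (suc n)
    p = + (E (suc k) * o (suc k) * P) (suc n)

  sign-cancel : ∀ k x → -1ℤ ℤ.^ k ℤ.* (-1ℤ ℤ.^ k ℤ.* x) ≡ x
  sign-cancel zero    x = ≡.trans (ℤ.*-identityˡ _) (ℤ.*-identityˡ x)
  sign-cancel (suc k) x = ≡.trans
    (solve 2 (λ s x → con -1ℤ :* s :* (con -1ℤ :* s :* x) := s :* (s :* x)) ≡.refl (-1ℤ ℤ.^ k) x)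
    (sign-cancel k x)
    where open ℤSolver.+-*-Solver

  signed-truncated-sum : ∀ n k → -1ℤ ℤ.^ k ℤ.* ∑[ i < suc k ] summand (suc n) (toℕ i) ≡ + U k (suc n)
  signed-truncated-sum n k = ≡.trans (≡.cong (-1ℤ ℤ.^ k ℤ.*_) (truncated-sum n k)) (sign-cancel k _)

-- The inequalities for `pod`

open import Data.Integer using (_+_; _-_; _*_; _^_; _≤_; _≥_; _>_)
open PodSeries using (summand; U-positive; signed-truncated-sum)

-- The signed sum is a coefficient of `U (k ∸ 1)`, hence a natural number.
truncation : (n k : ℕ) → n ℕ.≥ 1 → k ℕ.≥ 1 →
  let S = -1ℤ ^ (k ℕ.∸ 1) * ∑[ i < k ] summand n (toℕ i)
  in S ≥ 0ℤ × (n ℕ.≥ (2 ℕ.* k ℕ.+ 1) ℕ.* k → S > 0ℤ)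
truncation (suc n) (suc k) _ _ =
  ≡.subst (_≥ 0ℤ) (≡.sym (signed-truncated-sum n k)) (ℤ.+≤+ z≤n) ,
  λ m≤n → ≡.subst (_> 0ℤ) (≡.sym (signed-truncated-sum n k))
    (ℤ.+<+ (U-positive k (≡.subst (ℕ._≤ suc n) (ℕ.*-comm (2 ℕ.* suc k ℕ.+ 1) (suc k)) m≤n)))

-- The case k = 2, negated because the outer sign is -1.
four-terms : (n : ℕ) → n ℕ.≥ 1 →
  pod (+ n) - pod (+ n - + 1) - pod (+ n - + 3) + pod (+ n - + 6) ≤ 0ℤ
four-terms n n≥1 = ≡.subst (_≤ 0ℤ) (≡.trans
    (solve 4 (λ a b c d → :- (con -1ℤ :* (con 1ℤ :* (a :- b) :+ (con -1ℤ :* (c :- d) :+ con 0ℤ))) := a :- b :- c :+ d) ≡.refl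
      (pod (+ n - 0ℤ)) (pod (+ n - + 1)) (pod (+ n - + 3)) (pod (+ n - + 6)))
    -- The summand j = 0 contains `pod (+ n - 0ℤ)` where the statement has `pod (+ n)`.
    (≡.cong (λ m → pod m - pod (+ n - + 1) - pod (+ n - + 3) + pod (+ n - + 6)) (ℤ.+-identityʳ (+ n))))
  (ℤ.neg-mono-≤ (proj₁ (truncation n 2 n≥1 (s≤s z≤n))))
  where open ℤSolver.+-*-Solver

-- The case k = 3, with outer sign +1.
six-terms : (n : ℕ) → n ℕ.≥ 1 →
  pod (+ n) - pod (+ n - + 1) - pod (+ n - + 3) + pod (+ n - + 6)
    + pod (+ n - + 10) - pod (+ n - + 15) ≥ 0ℤ
six-terms n n≥1 = ≡.subst (_≥ 0ℤ) (≡.trans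
    (solve 6 (λ a b c d e f → con 1ℤ :* (con 1ℤ :* (a :- b) :+ (con -1ℤ :* (c :- d) :+ (con 1ℤ :* (e :- f) :+ con 0ℤ))) := a :- b :- c :+ d :+ e :- f) ≡.refl
      (pod (+ n - 0ℤ)) (pod (+ n - + 1)) (pod (+ n - + 3)) (pod (+ n - + 6)) (pod (+ n - + 10)) (pod (+ n - + 15)))
    (≡.cong (λ m → pod m - pod (+ n - + 1) - pod (+ n - + 3) + pod (+ n - + 6) + pod (+ n - + 10) - pod (+ n - + 15)) (ℤ.+-identityʳ (+ n))))
  (proj₁ (truncation n 3 n≥1 (s≤s z≤n)))
  where open ℤSolver.+-*-Solver

corollary1p4 :
  ((n k : ℕ) → n ℕ.≥ 1 → k ℕ.≥ 1 →
    let S = -1ℤ ^ (k ℕ.∸ 1) *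
              ∑[ i < k ] (let j = toℕ i in
                -1ℤ ^ j *
                  (pod (+ n - + (j ℕ.* (2 ℕ.* j ℕ.+ 1)))
                    - pod (+ n - + ((j ℕ.+ 1) ℕ.* (2 ℕ.* j ℕ.+ 1)))))
    in S ≥ 0ℤ × (n ℕ.≥ (2 ℕ.* k ℕ.+ 1) ℕ.* k → S > 0ℤ))
  × ((n : ℕ) → n ℕ.≥ 1 →
      pod (+ n) - pod (+ n - + 1) - pod (+ n - + 3) + pod (+ n - + 6) ≤ 0ℤ)
  × ((n : ℕ) → n ℕ.≥ 1 →
      pod (+ n) - pod (+ n - + 1) - pod (+ n - + 3) + pod (+ n - + 6)
        + pod (+ n - + 10) - pod (+ n - + 15) ≥ 0ℤ)
corollary1p4 = truncation , four-terms , six-terms
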